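{- Let $r\ge 0$ be an integer and let $G$ be a finite simple graph with at least $3$ vertices such that $\delta(G) \ge (r+1)\widetilde{\alpha}(G) + 3r$. Then $G$ contains $r+1$ pairwise edge-disjoint Hamilton cycles.
   Context: $\delta(G)$ is the minimum degree of $G$. For non-negative integers $s,t$, an $(s,t)$-bipartite-hole in $G$ consists of two disjoint vertex sets $S,T$ with $|S|=s$, $|T|=t$ and no edge of $G$ between $S$ and $T$. The bipartite-hole-number $\widetilde{\alpha}(G)$ is the least integer $r$ which can be written as $r=s+t-1$ for some positive integers $s,t$ such that $G$ contains no $(s,t)$-bipartite-hole. -}

module Defs where

open import Data.Nat using (ℕ; zero; suc; _+_; _*_; _∸_; _≤_; _<_)
open import Data.Fin using (Fin; toℕ)
open import Data.Fin.Subset using (Subset; _∈_; _∉_; ∣_∣)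
open import Data.List using (length; filter; allFin)
open import Data.Product using (Σ; ∃; ∃-syntax; _×_; _,_)
open import Data.Sum using (_⊎_)
open import Relation.Nullary using (¬_; Dec)
open import Relation.Binary.PropositionalEquality using (_≡_; _≢_)
open import Function.Definitions using (Injective)

record Graph (n : ℕ) : Set₁ where
  field
    Adj   : Fin n → Fin n → Set
    adj?  : (u v : Fin n) → Dec (Adj u v)
    sym   : ∀ {u v} → Adj u v → Adj v u
    irrefl : ∀ {u} → ¬ Adj u u
open Graph public

degree : ∀ {n} → Graph n → Fin n → ℕ
degree G u = length (filter (adj? G u) (allFin _))

MinDegree≥ : ∀ {n} → Graph n → ℕ → Set
MinDegree≥ G k = ∀ u → k ≤ degree G u

BipartiteHole : ∀ {n} → Graph n → ℕ → ℕ → Set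
BipartiteHole {n} G s t =
  Σ (Subset n) λ S → Σ (Subset n) λ T →
    (∀ x → x ∈ S → x ∉ T) × ∣ S ∣ ≡ s × ∣ T ∣ ≡ t ×
    (∀ u v → u ∈ S → v ∈ T → ¬ Adj G u v)

NoHoleWitness : ∀ {n} → Graph n → ℕ → Set
NoHoleWitness G r =
  ∃[ s ] ∃[ t ] (1 ≤ s × 1 ≤ t × r ≡ s + t ∸ 1 × ¬ BipartiteHole G s t)

IsBipartiteHoleNumber : ∀ {n} → Graph n → ℕ → Set
IsBipartiteHoleNumber G a =
  NoHoleWitness G a × (∀ r → NoHoleWitness G r → a ≤ r)

Consecutive : ∀ {n} → Fin n → Fin n → Set
Consecutive {n} i j = (suc (toℕ i) ≡ toℕ j) ⊎ (suc (toℕ i) ≡ n × toℕ j ≡ 0)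

-- a Hamilton cycle: a cyclic ordering σ of all vertices (σ bijective, being an
-- injection Fin n → Fin n) with consecutive vertices adjacent
record HamiltonCycle {n} (G : Graph n) : Set where
  field
    σ     : Fin n → Fin n
    σ-inj : Injective _≡_ _≡_ σ
    edges : ∀ i j → Consecutive i j → Adj G (σ i) (σ j)
open HamiltonCycle public

CycleEdge : ∀ {n} {G : Graph n} → HamiltonCycle G → Fin n → Fin n → Set
CycleEdge H u v =
  ∃[ i ] ∃[ j ] (Consecutive i j ×
    ((σ H i ≡ u × σ H j ≡ v) ⊎ (σ H i ≡ v × σ H j ≡ u)))

EdgeDisjoint : ∀ {n} {G : Graph n} → HamiltonCycle G → HamiltonCycle G → Set
EdgeDisjoint H K = ∀ u v → CycleEdge H u v → ¬ CycleEdge K u v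

-- Hamiltonicity.  Give a cyclic ordering of the vertices a cost: its number of consecutive
-- non-adjacent pairs.  If the cost is positive, cut the ordering at such a pair to get a sequence
-- v₀ … v_N with v₀ ≁ v_N.  Let l be the s-th index with v₀ ~ v_{l+1}.  Either
-- at least t neighbours of v_N come after v_l, and their successors together with the s predecessors
-- of neighbours of v₀ up to v_l are not an (s,t)-hole; or at least s neighbours of v_N come up to v_l,
-- and their predecessors together with the at least t predecessors of neighbours of v₀ from v_l on
-- are not a hole.  In both cases there is an edge between the two sets, and with it the three pieces
-- of the sequence can be reconnected to a cyclic ordering in which every new consecutive pair is an edge, so the cost drops.
--
-- Disjoint cycles.  After deleting k Hamilton cycles, s vertices lose at most 2ks neighbours, so
-- for s ≤ t an (s,t)-hole-free graph becomes (s, 2ks + t)-hole-free while degrees drop by at most 2k;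
-- the degree hypothesis lets this be repeated r + 1 times.
module Submission where

open import Defs hiding (sym)
open import Data.Nat using (ℕ; zero; suc; pred; _+_; _*_; _≤_; _<_; z≤n; s≤s; s≤s⁻¹)
open import Data.Nat.Properties
open import Data.Nat.Tactic.RingSolver using (solve-∀)
open import Data.Bool using (true; false)
open import Data.Fin using (Fin; zero; suc; toℕ)
open import Data.Fin.Properties using (toℕ-injective; toℕ<n; any?; all?) renaming (_≟_ to _≟F_)
open import Data.Fin.Subset using (Subset; inside; outside; ∣_∣; ⊥) renaming (_∈_ to _∈ₛ_; _∉_ to _∉ₛ_)
open import Data.Fin.Subset.Properties using (∉⊥; ∣⊥∣≡0)
open import Data.Vec using (_∷_; _[_]≔_; here; there)
open import Data.List using (List; []; _∷_; _++_; length; filter; map; take; reverse; allFin)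
open import Data.List.Properties
  using (length-++; length-map; length-take; filter-++; filter-accept; filter-reject; length-tabulate; unfold-reverse; map-∘; ++-assoc)
open import Data.List.Membership.Propositional using (_∈_; _∉_; find; lose)
open import Data.List.Membership.Propositional.Properties
  using (∈-filter⁻; ∈-map⁻; ∈-++⁺ˡ; ∈-++⁺ʳ)
import Data.List.Membership.DecPropositional as DecMembership
import Data.List.Relation.Unary.Any as Any
open Any using (here; there)
import Data.List.Relation.Unary.All as All
open All using (All; []; _∷_)
import Data.List.Relation.Unary.All.Properties as All
open import Data.List.Relation.Unary.AllPairs using ([]; _∷_)
open import Data.List.Relation.Unary.Unique.Propositional using (Unique)
import Data.List.Relation.Unary.Unique.Propositional.Properties as Unique
open import Data.List.Relation.Binary.Disjoint.Propositional using (Disjoint)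
open import Data.List.Relation.Binary.Permutation.Propositional using (_↭_; ↭⇒↭ₛ; ↭-reflexive; ↭-refl; ↭-sym; ↭-trans)
open import Data.List.Relation.Binary.Permutation.Propositional.Properties
  using (↭-length; filter-↭; ↭-reverse; ++⁺; ++⁺ˡ; ++⁺ʳ; ++-comm)
import Data.List.Relation.Binary.Permutation.Setoid.Properties as ↭ₛ
open import Data.Product using (Σ; ∃₂; ∃-syntax; _×_; _,_; proj₁; proj₂)
open import Data.Sum using (_⊎_; inj₁; inj₂; swap; [_,_])
open import Function using (_∘_; id; case_of_)
open import Relation.Nullary using (¬_; Dec; yes; no; does; ¬?; _×-dec_; _⊎-dec_; contradiction)
open import Relation.Unary using (Decidable)
open import Relation.Binary.PropositionalEquality
  using (_≡_; _≢_; refl; sym; trans; cong; cong₂; subst; subst₂; setoid)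

private
  variable
    A B : Set
    n : ℕ

-- Counting in lists

count : {P : A → Set} → Decidable P → List A → ℕ
count P? xs = length (filter P? xs)

count-++ : {P : A → Set} (P? : Decidable P) (xs ys : List A) →
           count P? (xs ++ ys) ≡ count P? xs + count P? ys
count-++ P? xs ys = trans (cong length (filter-++ P? xs ys)) (length-++ (filter P? xs))

count-map : {P : B → Set} (P? : Decidable P) (f : A → B) (xs : List A) →
            count P? (map f xs) ≡ count (P? ∘ f) xs
count-map P? f [] = refl
count-map P? f (x ∷ xs) with does (P? (f x))
... | true  = cong suc (count-map P? f xs)
... | false = count-map P? f xs

count-accept : {P : A → Set} (P? : Decidable P) {x : A} {xs : List A} → P x →
               count P? (x ∷ xs) ≡ suc (count P? xs)
count-accept P? Px = cong length (filter-accept P? Px)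

count-reject : {P : A → Set} (P? : Decidable P) {x : A} {xs : List A} → ¬ P x →
               count P? (x ∷ xs) ≡ count P? xs
count-reject P? ¬Px = cong length (filter-reject P? ¬Px)

count-filter-≤ : {P Q R : A → Set} (P? : Decidable P) (Q? : Decidable Q) (R? : Decidable R) →
                 (∀ {x} → P x → Q x → R x) → (xs : List A) →
                 count Q? (filter P? xs) ≤ count R? xs
count-filter-≤ P? Q? R? PQ⇒R [] = z≤n
count-filter-≤ P? Q? R? PQ⇒R (x ∷ xs) with ih ← count-filter-≤ P? Q? R? PQ⇒R xs | P? x | R? x
... | no _   | yes _  = m≤n⇒m≤1+n ih
... | no _   | no _   = ih
... | yes p  | r with Q? x | r
...   | no _   | yes _  = m≤n⇒m≤1+n ih
...   | no _   | no _   = ih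
...   | yes _  | yes _  = s≤s ih
...   | yes q  | no ¬r  = contradiction (PQ⇒R p q) ¬r

open module DecFin {n} = DecMembership (_≟F_ {n}) using (_∈?_; _∉?_)

length≤1+count-≢ : (x : Fin n) (ys : List (Fin n)) → Unique ys →
                   length ys ≤ suc (count (λ y → ¬? (y ≟F x)) ys)
length≤1+count-≢ x [] _ = z≤n
length≤1+count-≢ x (y ∷ ys) (y∉ ∷ u) with y ≟F x
... | no _     = s≤s (length≤1+count-≢ x ys u)
... | yes refl = s≤s (≤-reflexive (sym (all-≢ ys y∉)))
  where
  all-≢ : ∀ zs → All (x ≢_) zs → count (λ y → ¬? (y ≟F x)) zs ≡ length zs
  all-≢ [] [] = refl
  all-≢ (z ∷ zs) (x≢z ∷ p) =
    trans (count-accept (λ y → ¬? (y ≟F x)) (x≢z ∘ sym)) (cong suc (all-≢ zs p))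

-- The entries of `fs` are struck out of `ys` one at a time; without repetitions in `ys` each of
-- them costs at most one entry.
length≤length+count-∉ : (fs ys : List (Fin n)) → Unique ys →
                        length ys ≤ length fs + count (_∉? fs) ys
length≤length+count-∉ [] ys u = ≤-reflexive (sym (all-∉ ys))
  where
  all-∉ : ∀ zs → count (_∉? []) zs ≡ length zs
  all-∉ [] = refl
  all-∉ (z ∷ zs) = trans (count-accept (_∉? []) {z} {zs} (λ ())) (cong suc (all-∉ zs))
length≤length+count-∉ (f ∷ fs) ys u = begin
  length ys                                    ≤⟨ length≤1+count-≢ f ys u ⟩
  suc (length ys′)                             ≤⟨ s≤s (length≤length+count-∉ fs ys′ (Unique.filter⁺ ≢f? u)) ⟩
  suc (length fs + count (_∉? fs) ys′)         ≤⟨ s≤s (+-monoʳ-≤ (length fs)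
                                                      (count-filter-≤ ≢f? (_∉? fs) (_∉? (f ∷ fs)) both ys)) ⟩
  suc (length fs + count (_∉? (f ∷ fs)) ys)    ∎
  where
  open ≤-Reasoning
  ≢f? = λ y → ¬? (y ≟F f)
  ys′ = filter ≢f? ys
  both : ∀ {y} → y ≢ f → y ∉ fs → y ∉ f ∷ fs
  both y≢f _ (here y≡f) = y≢f y≡f
  both _ y∉fs (there y∈fs) = y∉fs y∈fs

-- Bipartite holes in terms of lists

insert : Fin n → Subset n → Subset n
insert x p = p [ x ]≔ inside

∈-insert⁻ : ∀ x (p : Subset n) {y} → y ∈ₛ insert x p → y ≡ x ⊎ y ∈ₛ p
∈-insert⁻ zero    (_ ∷ p) here        = inj₁ refl
∈-insert⁻ zero    (_ ∷ p) (there y∈p) = inj₂ (there y∈p)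
∈-insert⁻ (suc x) (_ ∷ p) here        = inj₂ here
∈-insert⁻ (suc x) (_ ∷ p) (there y∈)  = [ inj₁ ∘ cong suc , inj₂ ∘ there ] (∈-insert⁻ x p y∈)

∣insert∣ : ∀ x (p : Subset n) → x ∉ₛ p → ∣ insert x p ∣ ≡ suc ∣ p ∣
∣insert∣ zero    (inside  ∷ p) x∉p = contradiction here x∉p
∣insert∣ zero    (outside ∷ p) x∉p = refl
∣insert∣ (suc x) (inside  ∷ p) x∉p = cong suc (∣insert∣ x p (x∉p ∘ there))
∣insert∣ (suc x) (outside ∷ p) x∉p = ∣insert∣ x p (x∉p ∘ there)

fromUnique : (xs : List (Fin n)) → Unique xs →
             Σ (Subset n) λ S → ∣ S ∣ ≡ length xs × (∀ y → y ∈ₛ S → y ∈ xs)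
fromUnique {n} [] [] = ⊥ , ∣⊥∣≡0 n , λ y y∈⊥ → contradiction y∈⊥ ∉⊥
fromUnique (x ∷ xs) (x∉ ∷ u) with S , ∣S∣ , S⊆ ← fromUnique xs u =
  insert x S ,
  trans (∣insert∣ x S (λ x∈S → All.lookup x∉ (S⊆ x x∈S) refl)) (cong suc ∣S∣) ,
  λ y y∈ → [ here , there ∘ S⊆ y ] (∈-insert⁻ x S y∈)

-- The positive form of hole-freeness: it produces an edge. Lower bounds on the lengths, instead of
-- equalities, let it be applied to sets that are merely large enough.
Dense : Graph n → ℕ → ℕ → Set
Dense G s t = ∀ xs ys → Unique xs → Unique ys → Disjoint xs ys → s ≤ length xs → t ≤ length ys →
              ∃₂ λ x y → x ∈ xs × y ∈ ys × Adj G x y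

∈-take : ∀ k {x : A} {xs} → x ∈ take k xs → x ∈ xs
∈-take (suc k) {xs = _ ∷ _} (here x≡)  = here x≡
∈-take (suc k) {xs = _ ∷ _} (there x∈) = there (∈-take k x∈)

length-take-≤ : ∀ k (xs : List A) → k ≤ length xs → length (take k xs) ≡ k
length-take-≤ k xs k≤ = trans (length-take k xs) (m≤n⇒m⊓n≡m k≤)

-- Adjacency is decidable, so an edge can be searched for; if the search fails, cutting the lists to
-- exactly `s` and `t` entries gives a hole.
¬hole⇒dense : (G : Graph n) (s t : ℕ) → ¬ BipartiteHole G s t → Dense G s t
¬hole⇒dense G s t ¬hole xs ys uxs uys disj s≤ t≤
  with Any.any? (λ x → Any.any? (adj? G x) ys) xs
... | yes p with x , x∈ , q ← find p with y , y∈ , adj ← find q = x , y , x∈ , y∈ , adj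
... | no ¬p
  with S , ∣S∣ , S⊆ ← fromUnique (take s xs) (Unique.take⁺ s uxs)
     | T , ∣T∣ , T⊆ ← fromUnique (take t ys) (Unique.take⁺ t uys) =
  contradiction
    (S , T ,
     (λ x x∈S x∈T → disj (∈-take s (S⊆ x x∈S) , ∈-take t (T⊆ x x∈T))) ,
     trans ∣S∣ (length-take-≤ s xs s≤) ,
     trans ∣T∣ (length-take-≤ t ys t≤) ,
     λ u v u∈S v∈T adj → ¬p (lose (∈-take s (S⊆ u u∈S)) (lose (∈-take t (T⊆ v v∈T)) adj)))
    ¬hole

dense-sym : (G : Graph n) {s t : ℕ} → Dense G s t → Dense G t s
dense-sym G d xs ys uxs uys disj t≤ s≤
  with y , x , y∈ , x∈ , adj ← d ys xs uys uxs (λ (p , q) → disj (q , p)) s≤ t≤ =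
  x , y , x∈ , y∈ , Graph.sym G adj

-- Intervals of natural numbers and counting over them

range : ℕ → ℕ → List ℕ
range a zero    = []
range a (suc k) = a ∷ range (suc a) k

∈-range⁻ : ∀ a k {i} → i ∈ range a k → a ≤ i × i < a + k
∈-range⁻ a (suc k) (here refl) = ≤-refl , m<m+n a (s≤s z≤n)
∈-range⁻ a (suc k) {i} (there i∈) with a<i , i< ← ∈-range⁻ (suc a) k i∈ =
  <⇒≤ a<i , subst (i <_) (sym (+-suc a k)) i<

range-unique : ∀ a k → Unique (range a k)
range-unique a zero    = []
range-unique a (suc k) =
  All.tabulate (λ i∈ → <⇒≢ (proj₁ (∈-range⁻ (suc a) k i∈))) ∷ range-unique (suc a) k

range-++ : ∀ a k l → range a (k + l) ≡ range a k ++ range (a + k) l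
range-++ a zero    l = cong (λ b → range b l) (sym (+-identityʳ a))
range-++ a (suc k) l = cong (a ∷_) (trans (range-++ (suc a) k l)
  (cong (λ b → range (suc a) k ++ range b l) (sym (+-suc a k))))

range-suc : ∀ a k → range (suc a) k ≡ map suc (range a k)
range-suc a zero    = refl
range-suc a (suc k) = cong (suc a ∷_) (range-suc (suc a) k)

count-range-+ : {P : ℕ → Set} (P? : Decidable P) → ∀ a k l →
                count P? (range a (k + l)) ≡ count P? (range a k) + count P? (range (a + k) l)
count-range-+ P? a k l =
  trans (cong (count P?) (range-++ a k l)) (count-++ P? (range a k) (range (a + k) l))

count-range-suc : {P : ℕ → Set} (P? : Decidable P) → ∀ a k →
                  count P? (range (suc a) k) ≡ count (P? ∘ suc) (range a k)
count-range-suc P? a k = trans (cong (count P?) (range-suc a k)) (count-map P? suc (range a k))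

-- Finds the index `l` satisfying `P` that has exactly `s` such indices before it; `r` is the number
-- of positions left after `l`.
threshold : {P : ℕ → Set} (P? : Decidable P) → ∀ k s → s < count P? (range 0 k) →
            ∃₂ λ l r → k ≡ l + suc r × P l × count P? (range 0 l) ≡ s
threshold P? (suc k) s s< with P? 0 in eq
... | no ¬P0 with l , r , k≡ , Pl , c ← threshold (P? ∘ suc) k s (subst (s <_) (count-range-suc P? 0 k) s<) =
  suc l , r , cong suc k≡ , Pl ,
  trans (count-reject P? ¬P0) (trans (count-range-suc P? 0 l) c)
threshold P? (suc k) zero    s<       | yes P0 = 0 , k , refl , P0 , refl
threshold P? (suc k) (suc s) (s≤s s<) | yes P0
  with l , r , k≡ , Pl , c ← threshold (P? ∘ suc) k s (subst (s <_) (count-range-suc P? 0 k) s<) =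
  suc l , r , cong suc k≡ , Pl ,
  trans (count-accept P? P0) (cong suc (trans (count-range-suc P? 0 l) c))

-- Positions in lists without repetition

unique-map-on : (f : A → B) (xs : List A) →
                (∀ {x y} → x ∈ xs → y ∈ xs → f x ≡ f y → x ≡ y) → Unique xs → Unique (map f xs)
unique-map-on f []       inj []       = []
unique-map-on f (x ∷ xs) inj (x∉ ∷ u) =
  All.map⁺ (All.tabulate λ y∈ fx≡fy → All.lookup x∉ y∈ (inj (here refl) (there y∈) fx≡fy)) ∷
  unique-map-on f xs (λ p q → inj (there p) (there q)) u

-- The default d is returned for positions beyond the end of the list.
nth : A → List A → ℕ → A
nth d []       _       = d
nth d (x ∷ xs) zero    = x
nth d (x ∷ xs) (suc k) = nth d xs k

nth-∈ : ∀ (d : A) xs {k} → k < length xs → nth d xs k ∈ xs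
nth-∈ d (x ∷ xs) {zero}  _        = here refl
nth-∈ d (x ∷ xs) {suc k} (s≤s k<) = there (nth-∈ d xs k<)

nth-injective : ∀ (d : A) {xs} → Unique xs → ∀ {i j} → i < length xs → j < length xs →
                nth d xs i ≡ nth d xs j → i ≡ j
nth-injective d (x∉ ∷ u) {zero}  {zero}  _        _        _  = refl
nth-injective d {_ ∷ xs} (x∉ ∷ u) {zero}  {suc j} _        (s≤s j<) eq =
  contradiction eq (All.lookup x∉ (nth-∈ d xs j<))
nth-injective d {_ ∷ xs} (x∉ ∷ u) {suc i} {zero}  (s≤s i<) _        eq =
  contradiction (sym eq) (All.lookup x∉ (nth-∈ d xs i<))
nth-injective d (x∉ ∷ u) {suc i} {suc j} (s≤s i<) (s≤s j<) eq = cong suc (nth-injective d u i< j< eq)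

map-nth-range : ∀ (d : A) xs → map (nth d xs) (range 0 (length xs)) ≡ xs
map-nth-range d []       = refl
map-nth-range d (x ∷ xs) = cong (x ∷_)
  (trans (cong (map (nth d (x ∷ xs))) (range-suc 0 (length xs)))
  (trans (sym (map-∘ (range 0 (length xs)))) (map-nth-range d xs)))

-- Vertex sequences with a cost: joining, reversing and cutting

-- Path G x y p c: the list p runs from x to y, and at most c of its consecutive pairs are non-edges.
data Path (G : Graph n) : Fin n → Fin n → List (Fin n) → ℕ → Set where
  [_]  : ∀ x → Path G x x (x ∷ []) 0
  good : ∀ {x y z p c} → Adj G x y → Path G y z p c → Path G x z (x ∷ p) c
  bad  : ∀ {x y z p c} → Path G y z p c → Path G x z (x ∷ p) (suc c)

module _ {n} {G : Graph n} where

  private variable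
    a b x y z : Fin n
    p q : List (Fin n)
    c d : ℕ

  join : Path G x y p c → Adj G y a → Path G a b q d → Path G x b (p ++ q) (c + d)
  join [ _ ]      y~a Q = good y~a Q
  join (good e P) y~a Q = good e (join P y~a Q)
  join (bad P)    y~a Q = bad (join P y~a Q)

  snoc-bad : Path G x y p c → ∀ z → Path G x z (p ++ z ∷ []) (suc c)
  snoc-bad [ _ ]      z = bad [ z ]
  snoc-bad (good e P) z = good e (snoc-bad P z)
  snoc-bad (bad P)    z = bad (snoc-bad P z)

  reversed : Path G x y p c → Path G y x (reverse p) c
  reversed [ x ] = [ x ]
  reversed (good {x} {p = p} {c} e P) =
    subst₂ (Path G _ _) (sym (unfold-reverse x p)) (+-identityʳ c) (join (reversed P) (Graph.sym G e) [ x ])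
  reversed (bad {x} {p = p} P) =
    subst (λ q → Path G _ _ q _) (sym (unfold-reverse x p)) (snoc-bad (reversed P) x)

  -- The pair at the cut no longer counts, which is where the cost drops by one.
  first-bad : Path G x y p (suc c) →
              ∃₂ λ a b → ∃₂ λ q r → ∃₂ λ d e →
              Path G x a q d × Path G b y r e × p ≡ q ++ r × d + e ≡ c
  first-bad (good e P) with a , b , q , r , d , f , Q , R , eq , eq′ ← first-bad P =
    a , b , _ , r , d , f , good e Q , R , cong (_ ∷_) eq , eq′
  first-bad (bad P) = _ , _ , _ , _ , 0 , _ , [ _ ] , P , refl , refl

  path-length : Path G x y p c → ∃[ k ] length p ≡ suc k
  path-length [ x ] = 0 , refl
  path-length (good {p = p} _ _) = length p , refl
  path-length (bad {p = p} _) = length p , refl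

  nth-head : ∀ d → Path G x y p c → nth d p 0 ≡ x
  nth-head d [ x ]      = refl
  nth-head d (good _ _) = refl
  nth-head d (bad _)    = refl

  nth-last : ∀ d {k} → Path G x y p c → suc k ≡ length p → nth d p k ≡ y
  nth-last d [ x ] refl = refl
  nth-last d (good _ P) refl with k , eq ← path-length P rewrite eq = nth-last d P (sym eq)
  nth-last d (bad P)    refl with k , eq ← path-length P rewrite eq = nth-last d P (sym eq)

  nth-edges : ∀ d {k} → Path G x y p 0 → suc k < length p → Adj G (nth d p k) (nth d p (suc k))
  nth-edges d [ x ] (s≤s ())
  nth-edges d {zero}  (good e P) _        = subst (Adj G _) (sym (nth-head d P)) e
  nth-edges d {suc k} (good e P) (s≤s k<) = nth-edges d P k<

  -- The costs satisfy only an inequality because the pair at the cut may be a bad one. The last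
  -- component translates positions beyond the cut, so that the second piece can be cut again.
  split : ∀ d k → Path G x y p c → suc k < length p →
          ∃₂ λ q r → ∃₂ λ e f → Path G x (nth d p k) q e × Path G (nth d p (suc k)) y r f ×
          p ≡ q ++ r × e + f ≤ c × length p ≡ suc k + length r ×
          (∀ i → nth d p (suc k + i) ≡ nth d r i)
  split d k [ x ] (s≤s ())
  split d zero (good {x} {p = p} e P) _ =
    _ , p , 0 , _ , [ x ] , subst (λ a → Path G a _ _ _) (sym (nth-head d P)) P ,
    refl , ≤-refl , refl , λ i → refl
  split d zero (bad {x} {p = p} P) _ =
    _ , p , 0 , _ , [ x ] , subst (λ a → Path G a _ _ _) (sym (nth-head d P)) P ,
    refl , n≤1+n _ , refl , λ i → refl
  split d (suc k) (good {x} e P) (s≤s k<)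
    with q , r , f , g , Q , R , eq , ≤c , len , nth≡ ← split d k P k< =
    x ∷ q , r , f , g , good e Q , R , cong (x ∷_) eq , ≤c , cong suc len , nth≡
  split d (suc k) (bad {x} P) (s≤s k<)
    with q , r , f , g , Q , R , eq , ≤c , len , nth≡ ← split d k P k< =
    x ∷ q , r , suc f , g , bad Q , R , cong (x ∷_) eq , s≤s ≤c , cong suc len , nth≡

  split₃ : ∀ d {i j} → i < j → Path G x y p c → suc j < length p →
           ∃[ q ] ∃₂ λ r s → ∃[ e ] ∃₂ λ f g →
           Path G x (nth d p i) q e × Path G (nth d p (suc i)) (nth d p j) r f ×
           Path G (nth d p (suc j)) y s g × p ≡ q ++ r ++ s × e + (f + g) ≤ c
  split₃ {p = p} d {i} i<j P j< with k , refl ← m≤n⇒∃[o]m+o≡n i<j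
    with q , r′ , e , f′ , Q , R′ , refl , e+f′≤c , len , nth≡ ← split d i P (<-trans (s≤s i<j) j<)
    with r , s , f , g , R , S , refl , f+g≤f′ , _ , _ ←
      split d k R′ (+-cancelˡ-≤ (suc i) (suc (suc k)) _
        (subst₂ _≤_ (sym (trans (+-suc (suc i) (suc k)) (cong suc (+-suc (suc i) k)))) len j<)) =
    q , r , s , e , f , g , Q ,
    subst (λ a → Path G _ a r f) (sym (nth≡ k)) R ,
    subst (λ a → Path G a _ s g)
      (sym (trans (cong (nth d p) (sym (+-suc (suc i) k))) (nth≡ (suc k)))) S ,
    refl , ≤-trans (+-monoʳ-≤ e f+g≤f′) e+f′≤c

-- The exchange argument

allFin-unique : ∀ {p : List (Fin n)} → p ↭ allFin n → Unique p
allFin-unique {n} p↭ = ↭ₛ.Unique-resp-↭ (setoid (Fin n)) (↭⇒↭ₛ (↭-sym p↭)) (Unique.allFin⁺ n)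

↭-rotate₃ : (q r s : List A) → r ++ s ++ q ↭ q ++ r ++ s
↭-rotate₃ q r s = ↭-trans (↭-reflexive (sym (++-assoc r s q))) (++-comm (r ++ s) q)

cost-rotate₃ : ∀ e f g → f + (g + e) ≡ e + (f + g)
cost-rotate₃ = solve-∀

-- For hole sizes `suc s` and `suc t`, the degree bound `suc s + t` is their sum minus one, as in
-- the bipartite-hole-number.
module _ {n} (G : Graph n) {s t : ℕ} (dense : Dense G (suc s) (suc t)) (mindeg : MinDegree≥ G (suc s + t)) where

  module _ {x y : Fin n} {p : List (Fin n)} {c N} (P : Path G x y p c) (p↭ : p ↭ allFin n)
           (len : length p ≡ suc N) (¬yx : ¬ Adj G y x) where

    private
      v : ℕ → Fin n
      -- The default `x` is not reached at positions up to `N`, as `p` has `suc N` entries.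
      v = nth x p

      v-first : v 0 ≡ x
      v-first = nth-head x P

      v-last : v N ≡ y
      v-last = nth-last x P (sym len)

      I? : Decidable (λ i → Adj G x (v (suc i)))
      I? i = adj? G x (v (suc i))

      J? : Decidable (λ j → Adj G y (v j))
      J? j = adj? G y (v j)

    -- Since `p` lists every vertex once, degrees can be counted along the sequence.
    degree-range : ∀ u → degree G u ≡ count (λ i → adj? G u (v i)) (range 0 (suc N))
    degree-range u = trans (sym (↭-length (filter-↭ (adj? G u) p↭)))
      (trans (cong (count (adj? G u)) (sym (trans (cong (map v ∘ range 0) (sym len)) (map-nth-range x p))))
      (count-map (adj? G u) v (range 0 (suc N))))

    -- Density applied to the vertices at selected positions of two intervals. The first interval
    -- ends before the second begins and `v` is injective on positions, so the two vertex sets are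
    -- disjoint.
    connected : {Q R : ℕ → Set} (Q? : Decidable Q) (R? : Decidable R) →
                ∀ a k b l → a + k ≤ b → b + l ≤ suc N →
                suc s ≤ count Q? (range a k) → suc t ≤ count R? (range b l) →
                ∃₂ λ i j → i < a + k × b ≤ j × j < b + l × Q i × R j × Adj G (v i) (v j)
    connected Q? R? a k b l a+k≤b b+l≤ s< t< = indices (dense (map v is) (map v js)
      (unique-map-on v is (λ p q → v-inj (is< p) (is< q)) (Unique.filter⁺ Q? (range-unique a k)))
      (unique-map-on v js (λ p q → v-inj (js< p) (js< q)) (Unique.filter⁺ R? (range-unique b l)))
      disjoint
      (subst (suc s ≤_) (sym (length-map v is)) s<)
      (subst (suc t ≤_) (sym (length-map v js)) t<))
      where
      is = filter Q? (range a k)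
      js = filter R? (range b l)
      v-inj : ∀ {i j} → i < suc N → j < suc N → v i ≡ v j → i ≡ j
      v-inj i< j< = nth-injective x (allFin-unique p↭) (subst (_ <_) (sym len) i<) (subst (_ <_) (sym len) j<)
      is⁻ : ∀ {i} → i ∈ is → i ∈ range a k × _
      is⁻ = ∈-filter⁻ Q? {xs = range a k}
      js⁻ : ∀ {j} → j ∈ js → j ∈ range b l × _
      js⁻ = ∈-filter⁻ R? {xs = range b l}
      i<a+k : ∀ {i} → i ∈ is → i < a + k
      i<a+k i∈ = proj₂ (∈-range⁻ a k (proj₁ (is⁻ i∈)))
      is< : ∀ {i} → i ∈ is → i < suc N
      is< i∈ = <-≤-trans (i<a+k i∈) (≤-trans a+k≤b (≤-trans (m≤m+n b l) b+l≤))
      j-range : ∀ {j} → j ∈ js → b ≤ j × j < b + l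
      j-range j∈ = ∈-range⁻ b l (proj₁ (js⁻ j∈))
      js< : ∀ {j} → j ∈ js → j < suc N
      js< j∈ = <-≤-trans (proj₂ (j-range j∈)) b+l≤
      disjoint : Disjoint (map v is) (map v js)
      disjoint (w∈is , w∈js) with i , i∈ , w≡i ← ∈-map⁻ v w∈is with j , j∈ , w≡j ← ∈-map⁻ v w∈js =
        <⇒≢ (<-≤-trans (i<a+k i∈) (≤-trans a+k≤b (proj₁ (j-range j∈))))
            (v-inj (is< i∈) (js< j∈) (trans (sym w≡i) w≡j))
      indices : (∃₂ λ u w → u ∈ map v is × w ∈ map v js × Adj G u w) → _
      indices (u , w , u∈ , w∈ , adj) with i , i∈ , refl ← ∈-map⁻ v u∈ | j , j∈ , refl ← ∈-map⁻ v w∈ =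
        i , j , i<a+k i∈ , proj₁ (j-range j∈) , proj₂ (j-range j∈) ,
        proj₂ (is⁻ i∈) , proj₂ (js⁻ j∈) , adj

    CheaperCycle : Set
    CheaperCycle = ∃₂ λ a b → ∃₂ λ q d → Path G a b q d × Adj G b a × q ↭ allFin n × d ≤ c

    -- v₀…vᵢ | vᵢ₊₁…vⱼ | vⱼ₊₁…v_N  becomes  vᵢ₊₁…vⱼ, v_N…vⱼ₊₁, vᵢ…v₀.
    exchange-outer : ∀ {i j} → i < j → suc j < suc N →
                     Adj G x (v (suc i)) → Adj G y (v j) → Adj G (v i) (v (suc j)) → CheaperCycle
    exchange-outer i<j j< x~ y~ i~j
      with q , r , s , e , f , g , Q , R , S , refl , ≤c ← split₃ x i<j P (subst (_ <_) (sym len) j<) =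
      _ , _ , _ , _ ,
      join R (Graph.sym G y~) (join (reversed S) (Graph.sym G i~j) (reversed Q)) , x~ ,
      ↭-trans (++⁺ˡ r (++⁺ (↭-reverse s) (↭-reverse q))) (↭-trans (↭-rotate₃ q r s) p↭) ,
      ≤-trans (≤-reflexive (cost-rotate₃ e f g)) ≤c

    -- v₀…vⱼ | vⱼ₊₁…vᵢ | vᵢ₊₁…v_N  becomes  vᵢ…vⱼ₊₁, v_N…vᵢ₊₁, v₀…vⱼ.
    exchange-inner : ∀ {i j} → j < i → suc i < suc N →
                     Adj G x (v (suc i)) → Adj G y (v (suc j)) → Adj G (v j) (v i) → CheaperCycle
    exchange-inner j<i i< x~ y~ j~i
      with q , r , s , e , f , g , Q , R , S , refl , ≤c ← split₃ x j<i P (subst (_ <_) (sym len) i<) =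
      _ , _ , _ , _ ,
      join (reversed R) (Graph.sym G y~) (join (reversed S) (Graph.sym G x~) Q) , j~i ,
      ↭-trans (++⁺ (↭-reverse r) (++⁺ʳ q (↭-reverse s))) (↭-trans (↭-rotate₃ q r s) p↭) ,
      ≤-trans (≤-reflexive (cost-rotate₃ e f g)) ≤c

    -- No neighbour of `x` is lost in passing to predecessors: position 0 is `x` itself.
    count-I : suc s + t ≤ count I? (range 0 N)
    count-I = subst (suc s + t ≤_)
      (trans (degree-range x) (trans
        (count-reject (λ i → adj? G x (v i)) {0} {range 1 N} (λ x~x → Graph.irrefl G (subst (Adj G x) v-first x~x)))
        (count-range-suc (λ i → adj? G x (v i)) 0 N)))
      (mindeg x)

    -- The first term counts predecessors of neighbours of y, the second one successors.
    count-J : ∀ l r → N ≡ l + suc r →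
              suc s + t ≤ count (J? ∘ suc) (range 0 l) + count (J? ∘ pred) (range (2 + l) r)
    count-J l r refl = subst (suc s + t ≤_)
      (trans (degree-range y) (trans (count-range-+ J? 0 (suc l) (suc r)) (cong₂ _+_ before after)))
      (mindeg y)
      where
      -- Position 0 contributes nothing because `y` is not adjacent to `x`.
      before : count J? (range 0 (suc l)) ≡ count (J? ∘ suc) (range 0 l)
      before = trans
        (count-reject J? {0} {range 1 l} (λ y~x → ¬yx (subst (Adj G y) v-first y~x)))
        (count-range-suc J? 0 l)
      -- The last position is `y` itself, so dropping it loses no neighbour and all the others have
      -- a successor.
      after : count J? (range (suc l) (suc r)) ≡ count (J? ∘ pred) (range (2 + l) r)
      after = trans (cong (count J? ∘ range (suc l)) (+-comm 1 r))
        (trans (count-range-+ J? (suc l) r 1)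
        (trans (cong₂ _+_ (sym (count-range-suc (J? ∘ pred) (suc l) r))
          (count-reject J? {suc l + r} {[]} (λ y~y →
            Graph.irrefl G (subst (Adj G y) (trans (cong v (sym (+-suc l r))) v-last) y~y))))
        (+-identityʳ _)))

    improve : CheaperCycle
    -- Exactly `s` indices in `I?` precede `l`, and `l` is one too: there are `suc s` of them up to
    -- `l` and at least `suc t` from `l` on. Both cases let `l` count on the side they need.
    improve with l , r , N≡ , Il , #l ← threshold I? N s (≤-trans (m≤m+n (suc s) t) count-I)
      with suc s ≤? count (J? ∘ suc) (range 0 l)
    ... | yes s<
      with j , i , j<l , l≤i , i< , y~ , x~ , j~i ←
        connected (J? ∘ suc) I? 0 l l (suc r) ≤-refl (≤-trans (≤-reflexive (sym N≡)) (n≤1+n N)) s<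
          (+-cancelˡ-≤ s _ _ (subst₂ _≤_ (sym (+-suc s t))
            (trans (cong (count I? ∘ range 0) N≡) (trans (count-range-+ I? 0 l (suc r)) (cong (_+ count I? (range l (suc r))) #l)))
            count-I)) =
      exchange-inner (<-≤-trans j<l l≤i) (s≤s (subst (i <_) (sym N≡) i<)) x~ y~ j~i
    -- At most `s` neighbours of `y` lie at positions up to `l`, so at least `suc t` lie beyond;
    -- their successors start at position `2 + l`.
    ... | no s≮
      with connected I? (J? ∘ pred) 0 (suc l) (2 + l) r (n≤1+n _)
          (s≤s (≤-reflexive (sym (trans N≡ (+-suc l r)))))
          (≤-reflexive (sym (trans (cong (count I? ∘ range 0) (+-comm 1 l))
            (trans (count-range-+ I? 0 l 1)
            (trans (cong₂ _+_ #l (count-accept I? {l} {[]} Il)) (+-comm s 1))))))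
          (+-cancelˡ-≤ s _ _ (≤-trans (≤-reflexive (+-suc s t))
            (≤-trans (count-J l r N≡) (+-monoˡ-≤ _ (s≤s⁻¹ (≰⇒> s≮))))))
    ... | i , suc j , i<l , s≤s l<j , j< , x~ , y~ , i~j =
      exchange-outer (<-≤-trans i<l l<j)
        (subst (suc j <_) (cong suc (sym (trans N≡ (+-suc l r)))) j<) x~ y~ i~j

  -- Lowering the cost to zero

  GoodCycle : Set
  GoodCycle = ∃₂ λ x y → ∃[ p ] (Path G x y p 0 × Adj G y x × p ↭ allFin n)

  -- Mutual induction on the budget `m`. A closed sequence of positive cost is cut at a bad pair and
  -- glued along its closing edge, which lowers the budget; an open one is closed within the same
  -- budget, directly or by `improve`.
  closed⇒good : ∀ m {x y p c} → c ≤ m → Path G x y p c → Adj G y x → p ↭ allFin n → GoodCycle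
  open⇒good   : ∀ m {x y p c} → c ≤ m → Path G x y p c → p ↭ allFin n → GoodCycle

  closed⇒good m {c = zero} _ P y~x p↭ = _ , _ , _ , P , y~x , p↭
  closed⇒good (suc m) {c = suc c} (s≤s c≤m) P y~x p↭
    with _ , _ , q , r , d , e , Q , R , refl , refl ← first-bad P =
    open⇒good m (≤-trans (≤-reflexive (+-comm e d)) c≤m) (join R y~x Q) (↭-trans (++-comm r q) p↭)

  open⇒good m {x} {y} c≤m P p↭ with adj? G y x
  ... | yes y~x = closed⇒good m c≤m P y~x p↭
  ... | no ¬yx with _ , _ , _ , _ , Q , adj , q↭ , ≤c ← improve P p↭ (proj₂ (path-length P)) ¬yx =
    closed⇒good m (≤-trans ≤c c≤m) Q adj q↭

  good⇒hamilton : GoodCycle → HamiltonCycle G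
  good⇒hamilton (x , y , p , P , y~x , p↭) = record
    { σ     = λ i → nth x p (toℕ i)
    ; σ-inj = λ {i} {j} eq → toℕ-injective (nth-injective x (allFin-unique p↭) (toℕ<len i) (toℕ<len j) eq)
    ; edges = consecutive
    }
    where
    len : length p ≡ n
    len = trans (↭-length p↭) (length-tabulate id)
    toℕ<len : ∀ i → toℕ i < length p
    toℕ<len i = subst (toℕ i <_) (sym len) (toℕ<n i)
    consecutive : ∀ i j → Consecutive i j → Adj G (nth x p (toℕ i)) (nth x p (toℕ j))
    consecutive i j (inj₁ i+1≡j) = subst (λ k → Adj G _ (nth x p k)) i+1≡j
      (nth-edges x P (subst (_< length p) (sym i+1≡j) (toℕ<len j)))
    consecutive i j (inj₂ (i+1≡n , j≡0)) = subst₂ (Adj G)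
      (sym (nth-last x P (trans i+1≡n (sym len))))
      (sym (trans (cong (nth x p) j≡0) (nth-head x P)))
      y~x

-- `bad` accepts adjacent pairs as well, so any ordering is a path once all its pairs are declared
-- bad.
some-path : (G : Graph n) → ∀ x xs → ∃₂ λ y c → Path G x y (x ∷ xs) c
some-path G x []       = x , 0 , [ x ]
some-path G x (z ∷ xs) with y , c , P ← some-path G z xs = y , suc c , bad P

dense⇒hamilton : (G : Graph (suc n)) {s t : ℕ} → Dense G (suc s) (suc t) → MinDegree≥ G (suc s + t) →
                 HamiltonCycle G
dense⇒hamilton G dense mindeg with y , c , P ← some-path G _ _ =
  good⇒hamilton G dense mindeg (open⇒good G dense mindeg c ≤-refl P ↭-refl)

-- Neighbours along Hamilton cycles

enumerate-subsingleton : {P : Fin n → Set} → Decidable P → (∀ {x y} → P x → P y → x ≡ y) →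
                             ∃[ fs ] (length fs ≤ 1 × (∀ {x} → P x → x ∈ fs))
enumerate-subsingleton P? unique with any? P?
... | yes (x , Px) = x ∷ [] , ≤-refl , λ Py → here (unique Py Px)
... | no ¬∃        = [] , z≤n , λ Px → contradiction (_ , Px) ¬∃

consecutive? : (i j : Fin n) → Dec (Consecutive i j)
consecutive? {n} i j = (suc (toℕ i) ≟ toℕ j) ⊎-dec ((suc (toℕ i) ≟ n) ×-dec (toℕ j ≟ 0))

consecutive-functional : {i j k : Fin n} → Consecutive i j → Consecutive i k → j ≡ k
consecutive-functional (inj₁ p) (inj₁ q) = toℕ-injective (trans (sym p) q)
consecutive-functional {j = j} (inj₁ p) (inj₂ (q , _)) = contradiction (trans (sym p) q) (<⇒≢ (toℕ<n j))
consecutive-functional {k = k} (inj₂ (q , _)) (inj₁ p) = contradiction (trans (sym p) q) (<⇒≢ (toℕ<n k))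
consecutive-functional (inj₂ (_ , p)) (inj₂ (_ , q)) = toℕ-injective (trans p (sym q))

consecutive-injective : {i j k : Fin n} → Consecutive i k → Consecutive j k → i ≡ j
consecutive-injective (inj₁ p) (inj₁ q) = toℕ-injective (suc-injective (trans p (sym q)))
consecutive-injective (inj₁ p) (inj₂ (_ , q)) = case trans p q of λ ()
consecutive-injective (inj₂ (_ , q)) (inj₁ p) = case trans p q of λ ()
consecutive-injective (inj₂ (p , _)) (inj₂ (q , _)) = toℕ-injective (suc-injective (trans p (sym q)))

module _ {n} {G : Graph n} where

  cycleEdge? : (H : HamiltonCycle G) → ∀ u v → Dec (CycleEdge H u v)
  cycleEdge? H u v = any? λ i → any? λ j → consecutive? i j ×-dec
    (((σ H i ≟F u) ×-dec (σ H j ≟F v)) ⊎-dec ((σ H i ≟F v) ×-dec (σ H j ≟F u)))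

  cycleEdge-sym : (H : HamiltonCycle G) → ∀ {u v} → CycleEdge H u v → CycleEdge H v u
  cycleEdge-sym H (i , j , ij , e) = i , j , ij , swap e

  -- The edges oriented along `σ`. Unlike an undirected edge, an arc is determined by its start, and
  -- also by its end.
  CycleArc : HamiltonCycle G → Fin n → Fin n → Set
  CycleArc H u v = ∃₂ λ i j → Consecutive i j × σ H i ≡ u × σ H j ≡ v

  cycleArc? : (H : HamiltonCycle G) → ∀ u v → Dec (CycleArc H u v)
  cycleArc? H u v = any? λ i → any? λ j → consecutive? i j ×-dec ((σ H i ≟F u) ×-dec (σ H j ≟F v))

  cycleArc-functional : (H : HamiltonCycle G) → ∀ {u v w} → CycleArc H u v → CycleArc H u w → v ≡ w
  cycleArc-functional H (i , j , ij , i↦u , refl) (k , l , kl , k↦u , refl)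
    with refl ← σ-inj H (trans i↦u (sym k↦u)) = cong (σ H) (consecutive-functional ij kl)

  cycleArc-injective : (H : HamiltonCycle G) → ∀ {u v w} → CycleArc H v u → CycleArc H w u → v ≡ w
  cycleArc-injective H (i , j , ij , refl , j↦u) (k , l , kl , refl , l↦u)
    with refl ← σ-inj H (trans j↦u (sym l↦u)) = cong (σ H) (consecutive-injective ij kl)

  -- An edge at `u` is an arc leaving `u` or an arc entering it, and there is at most one of each.
  cycle-neighbours : (H : HamiltonCycle G) → ∀ u →
                     ∃[ fs ] (length fs ≤ 2 × (∀ {v} → CycleEdge H u v → v ∈ fs))
  cycle-neighbours H u
    with fs , ≤1 , fs∋ ← enumerate-subsingleton (cycleArc? H u) (cycleArc-functional H)
       | gs , ≤1′ , gs∋ ← enumerate-subsingleton (λ v → cycleArc? H v u) (cycleArc-injective H) =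
    fs ++ gs , ≤-trans (≤-reflexive (length-++ fs)) (+-mono-≤ ≤1 ≤1′) ,
    λ where (i , j , ij , inj₁ (p , q)) → ∈-++⁺ˡ (fs∋ (i , j , ij , p , q))
            (i , j , ij , inj₂ (p , q)) → ∈-++⁺ʳ fs (gs∋ (i , j , ij , p , q))

  cycles-neighbours : ∀ {k} (H : Fin k → HamiltonCycle G) → ∀ u →
                      ∃[ fs ] (length fs ≤ 2 * k × (∀ i {v} → CycleEdge (H i) u v → v ∈ fs))
  cycles-neighbours {zero}  H u = [] , z≤n , λ ()
  cycles-neighbours {suc k} H u
    with fs , ≤2 , fs∋ ← cycle-neighbours (H zero) u
       | gs , ≤2k , gs∋ ← cycles-neighbours (H ∘ suc) u =
    fs ++ gs ,
    ≤-trans (≤-reflexive (length-++ fs)) (≤-trans (+-mono-≤ ≤2 ≤2k) (≤-reflexive (sym (*-suc 2 k)))) ,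
    λ where zero e → ∈-++⁺ˡ (fs∋ e)
            (suc i) e → ∈-++⁺ʳ fs (gs∋ i e)

  -- Deleting Hamilton cycles

  module _ {k} (H : Fin k → HamiltonCycle G) where

    removeCycles : Graph n
    removeCycles = record
      { Adj    = λ u v → Adj G u v × (∀ i → ¬ CycleEdge (H i) u v)
      ; adj?   = λ u v → adj? G u v ×-dec all? (λ i → ¬? (cycleEdge? (H i) u v))
      ; sym    = λ (u~v , ¬e) → Graph.sym G u~v , λ i e → ¬e i (cycleEdge-sym (H i) e)
      ; irrefl = λ (u~u , _) → Graph.irrefl G u~u
      }

    -- Every neighbour outside the at most `2 * k` cycle neighbours of `u` survives.
    removeCycles-degree : ∀ u → degree G u ≤ 2 * k + degree removeCycles u
    removeCycles-degree u with fs , ≤2k , fs∋ ← cycles-neighbours H u =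
      ≤-trans (length≤length+count-∉ fs (filter (adj? G u) (allFin n)) (Unique.filter⁺ (adj? G u) (Unique.allFin⁺ n)))
        (+-mono-≤ ≤2k (count-filter-≤ (adj? G u) (_∉? fs) (adj? removeCycles u)
          (λ u~v v∉ → u~v , λ i e → v∉ (fs∋ i e)) (allFin n)))

    list-neighbours : ∀ us → ∃[ fs ] (length fs ≤ 2 * k * length us ×
                      (∀ {u} → u ∈ us → ∀ i {v} → CycleEdge (H i) u v → v ∈ fs))
    list-neighbours [] = [] , z≤n , λ ()
    list-neighbours (u ∷ us)
      with fs , ≤2k , fs∋ ← cycles-neighbours H u
         | gs , ≤us , gs∋ ← list-neighbours us =
      fs ++ gs ,
      ≤-trans (≤-reflexive (length-++ fs)) (≤-trans (+-mono-≤ ≤2k ≤us) (≤-reflexive (sym (*-suc (2 * k) (length us))))) ,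
      λ where (here refl) i e → ∈-++⁺ˡ (fs∋ i e)
              (there u∈) i e → ∈-++⁺ʳ fs (gs∋ u∈ i e)

    -- Cutting `xs` to `s` vertices leaves at most `2 * k * s` cycle neighbours to strike out of
    -- `ys`. At least `t` vertices remain, and an edge to one of them lies on none of the cycles.
    removeCycles-dense : ∀ {s t} → Dense G s t → Dense removeCycles s (2 * k * s + t)
    removeCycles-dense {s} {t} dense xs ys uxs uys disj s≤ t≤
      with fs , ≤fs , fs∋ ← list-neighbours (take s xs)
      with x , y , x∈ , y∈ , adj ← dense (take s xs) (filter (_∉? fs) ys)
             (Unique.take⁺ s uxs) (Unique.filter⁺ (_∉? fs) uys)
             (λ (p , q) → disj (∈-take s p , proj₁ (∈-filter⁻ (_∉? fs) {xs = ys} q)))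
             (≤-reflexive (sym (length-take-≤ s xs s≤)))
             (+-cancelˡ-≤ (2 * k * s) _ _ (≤-trans t≤ (≤-trans (length≤length+count-∉ fs ys uys)
               (+-monoˡ-≤ _ (subst (λ m → length fs ≤ 2 * k * m) (length-take-≤ s xs s≤) ≤fs)))))
      with y∈ys , y∉fs ← ∈-filter⁻ (_∉? fs) {xs = ys} y∈ =
      x , y , ∈-take s x∈ , y∈ys , adj , λ i e → y∉fs (fs∋ x∈ i e)

    extend : HamiltonCycle removeCycles → Fin (suc k) → HamiltonCycle G
    extend K zero    = record { σ = σ K ; σ-inj = σ-inj K ; edges = λ i j ij → proj₁ (edges K i j ij) }
    extend K (suc i) = H i

    extend-disjoint : (∀ i j → i ≢ j → EdgeDisjoint (H i) (H j)) → ∀ K i j → i ≢ j →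
                      EdgeDisjoint (extend K i) (extend K j)
    extend-disjoint disj K = λ where
        zero    zero    0≢0 → contradiction refl 0≢0
        zero    (suc j) _   u v eK eH → avoids eK j eH
        (suc i) zero    _   u v eH eK → avoids eK i eH
        (suc i) (suc j) i≢j → disj i j (i≢j ∘ cong suc)
      where
      avoids : ∀ {u v} → CycleEdge (extend K zero) u v → ∀ i → ¬ CycleEdge (H i) u v
      avoids (a , b , ab , inj₁ (refl , refl)) = proj₂ (edges K a b ab)
      -- Here the arc runs from `v` to `u`, so the old edge has to be turned round first.
      avoids (a , b , ab , inj₂ (refl , refl)) i e = proj₂ (edges K a b ab) i (cycleEdge-sym (H i) e)

-- Collecting edge-disjoint cycles

DisjointCycles : Graph n → ℕ → Set
DisjointCycles G k = Σ (Fin k → HamiltonCycle G) λ H → ∀ i j → i ≢ j → EdgeDisjoint (H i) (H j)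

-- The hypothesis s ≤ t enters the degree bound through 2ks ≤ ks + kt.
disjoint-cycles : (G : Graph (suc n)) {s t : ℕ} → s ≤ t → Dense G (suc s) (suc t) → ∀ r →
                  MinDegree≥ G ((r + 1) * (suc s + t) + 3 * r) → ∀ k → k ≤ suc r → DisjointCycles G k
disjoint-cycles G s≤t dense r mindeg zero _ = (λ ()) , λ ()
disjoint-cycles G {s} {t} s≤t dense r mindeg (suc k) (s≤s k≤r)
  with H , disj ← disjoint-cycles G s≤t dense r mindeg k (m≤n⇒m≤1+n k≤r) =
  extend H K , extend-disjoint H disj K
  where
  open ≤-Reasoning
  -- Deleted degrees give `2 * k` and the enlarged hole size gives `2 * k * suc s`. Of the resulting
  -- 4k, one k goes into the product, which leaves `3 * k`; of the 2ks, one ks does too, and the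
  -- other is compared with `k * t`, added for this purpose.
  regroup : ∀ k s t → 2 * k + (suc s + (2 * k * suc s + t)) + k * t ≡ (k + 1) * (suc s + t) + 3 * k + k * s
  regroup = solve-∀
  bound : ∀ u → 2 * k + (suc s + (2 * k * suc s + t)) ≤ 2 * k + degree (removeCycles H) u
  bound u = ≤-trans (+-cancelʳ-≤ (k * t) _ _ (begin
    2 * k + (suc s + (2 * k * suc s + t)) + k * t    ≡⟨ regroup k s t ⟩
    (k + 1) * (suc s + t) + 3 * k + k * s            ≤⟨ +-mono-≤
      (+-mono-≤ (*-monoˡ-≤ (suc s + t) (+-monoˡ-≤ 1 k≤r)) (*-monoʳ-≤ 3 k≤r)) (*-monoʳ-≤ k s≤t) ⟩
    (r + 1) * (suc s + t) + 3 * r + k * t            ≤⟨ +-monoˡ-≤ (k * t) (mindeg u) ⟩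
    degree G u + k * t                               ∎)) (removeCycles-degree H u)
  K = dense⇒hamilton (removeCycles H)
    (subst (Dense (removeCycles H) (suc s)) (+-suc (2 * k * suc s) t) (removeCycles-dense H dense))
    (λ u → +-cancelˡ-≤ (2 * k) _ _ (bound u))

theorem3 : (r n : ℕ) → 3 ≤ n → (G : Graph n) → (a : ℕ) →
    IsBipartiteHoleNumber G a →
    MinDegree≥ G ((r + 1) * a + 3 * r) →
    Σ (Fin (suc r) → HamiltonCycle G) λ H →
    ∀ i j → i ≢ j → EdgeDisjoint (H i) (H j)
theorem3 r (suc n) _ G a ((suc s , suc t , _ , _ , refl , ¬hole) , _) mindeg with ≤-total s t
... | inj₁ s≤t = disjoint-cycles G s≤t dense r mindeg′ (suc r) ≤-refl
  where
  dense = ¬hole⇒dense G (suc s) (suc t) ¬hole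
  -- After matching, `a` is `s + suc t`, which has to be brought into the form `suc s + t`.
  mindeg′ = subst (λ a → MinDegree≥ G ((r + 1) * a + 3 * r)) (+-suc s t) mindeg
-- The loss of density is proportional to the first size, so the smaller one is put first.
... | inj₂ t≤s = disjoint-cycles G t≤s dense r mindeg′ (suc r) ≤-refl
  where
  dense = dense-sym G (¬hole⇒dense G (suc s) (suc t) ¬hole)
  mindeg′ = subst (λ a → MinDegree≥ G ((r + 1) * a + 3 * r)) (+-comm s (suc t)) mindeg
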